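{- Let $n,m\ge 1$, let $g_1,\ldots,g_m$ be computable functions from $\mathbb{Z}^{n+1}$ to $\mathbb{Z}^n$, and let $PROG=(S,I,R)$ be the while-loop program with variables $x[1],\ldots,x[n]$ determined by $g_1,\ldots,g_m$. Assume that for each computational segment $t_1,\ldots,t_L$ with $L\ge 2$ there exists $k$ with $1\le k\le n$ such that the value of $x[k]$ in $t_L$ is strictly less than the value of $x[k]$ in $t_1$. Then any computation of $PROG$ is finite.
   Context: The while-loop program determined by $g_1,\ldots,g_m:\mathbb{Z}^{n+1}\to\mathbb{Z}^n$ is the following. The state is $X=(x[1],\ldots,x[n])\in\mathbb{Z}^n$; initially $X$ is an arbitrary element of $\mathbb{Z}^n$ supplied by the user. While $x[1]>0$ and $x[2]>0$ and $\cdots$ and $x[n]>0$, the user chooses $\mathrm{control}=i\in\{1,\ldots,m\}$ and an integer $u\in\mathbb{Z}$, and $X$ is replaced by $g_i(X,u)$. Formally $S=I=\mathbb{Z}^n$, and $R(s,t)$ holds iff all coordinates of $s$ are positive and there exist $i\in\{1,\ldots,m\}$ and $u\in\mathbb{Z}$ with $t=g_i(s,u)$. A computation is a finite or infinite sequence of states $s_1,s_2,\ldots$ with $s_1\in I$, with $R(s_i,s_{i+1})$ for all consecutive terms, and such that if the sequence is finite with last state $s$ then there is no $t$ with $R(s,t)$. A computational segment is a finite sequence of states $t_1,\ldots,t_L$ such that $R(t_i,t_{i+1})$ for all $1\le i\le L-1$ (it is not required that $t_1\in I$ or that $t_L$ be terminal). -}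

module Defs where

open import Data.Fin using (Fin; zero; suc; inject₁; fromℕ)
open import Data.Integer as ℤ using (ℤ; +_; -[1+_]; 0ℤ)
open import Data.Nat using (ℕ; zero; suc; _+_; _*_; _<_)
open import Data.Product using (∃-syntax; _×_)
open import Data.Vec using (Vec; []; _∷_; _∷ʳ_; lookup; map)
open import Relation.Binary using (Rel)
open import Relation.Binary.PropositionalEquality using (_≡_)
open import Relation.Nullary using (¬_)
open import Relation.Unary using (Pred; U)
open import Level using (0ℓ)

-- Codes of partial recursive functions ℕᵏ ⇀ ℕ.
data Rec : ℕ → Set where
  zer  : ∀ {k} → Rec k
  succ : Rec 1
  proj : ∀ {k} → Fin k → Rec k
  comp : ∀ {j k} → Rec j → Vec (Rec k) j → Rec k
  prec : ∀ {k} → Rec k → Rec (2 + k) → Rec (1 + k)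
  mu   : ∀ {k} → Rec (1 + k) → Rec k

infix 4 _[_]⇓_

-- e [ xs ]⇓ y : the partial function coded by e is defined at xs, with value y.
data _[_]⇓_ : ∀ {k} → Rec k → Vec ℕ k → ℕ → Set where
  ⇓zer   : ∀ {k} {xs : Vec ℕ k} → zer [ xs ]⇓ 0
  ⇓succ  : ∀ {x} → succ [ x ∷ [] ]⇓ suc x
  ⇓proj  : ∀ {k} {xs : Vec ℕ k} (i : Fin k) → proj i [ xs ]⇓ lookup xs i
  ⇓comp  : ∀ {j k} {f : Rec j} {gs : Vec (Rec k) j} {xs : Vec ℕ k} {y} (ws : Vec ℕ j) →
           (∀ i → lookup gs i [ xs ]⇓ lookup ws i) →
           f [ ws ]⇓ y →
           comp f gs [ xs ]⇓ y
  ⇓prec0 : ∀ {k} {f : Rec k} {h : Rec (2 + k)} {xs : Vec ℕ k} {y} →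
           f [ xs ]⇓ y →
           prec f h [ 0 ∷ xs ]⇓ y
  ⇓precS : ∀ {k} {f : Rec k} {h : Rec (2 + k)} {xs : Vec ℕ k} {x w y} →
           prec f h [ x ∷ xs ]⇓ w →
           h [ x ∷ w ∷ xs ]⇓ y →
           prec f h [ suc x ∷ xs ]⇓ y
  ⇓mu    : ∀ {k} {f : Rec (1 + k)} {xs : Vec ℕ k} {y} →
           (∀ z → z < y → ∃[ w ] f [ z ∷ xs ]⇓ suc w) →
           f [ y ∷ xs ]⇓ 0 →
           mu f [ xs ]⇓ y

-- A bijection ℤ → ℕ through which computability is transferred to ℤ.
code : ℤ → ℕ
code (+ n)    = 2 * n
code -[1+ n ] = 1 + 2 * n

Computable : ∀ {a b} → (Vec ℤ a → Vec ℤ b) → Set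
Computable {a} {b} g =
  ∀ (j : Fin b) → ∃[ e ] (∀ (xs : Vec ℤ a) → e [ map code xs ]⇓ code (lookup (g xs) j))

record Program : Set₁ where
  field
    S : Set
    I : Pred S 0ℓ
    R : Rel S 0ℓ

module _ (P : Program) where
  open Program P

  -- The sequence t₁,…,t_L with L = suc ℓ; t₁ is at index zero and t_L at fromℕ ℓ.
  record Segment (ℓ : ℕ) : Set where
    field
      state : Fin (suc ℓ) → S
      step  : ∀ (i : Fin ℓ) → R (state (inject₁ i)) (state (suc i))

    first last : S
    first = state zero
    last  = state (fromℕ ℓ)

  data Computation : Set where
    finite   : ∀ {ℓ} (t : Segment ℓ) →
               I (Segment.first t) →
               ¬ (∃[ s ] R (Segment.last t) s) →
               Computation
    infinite : (s : ℕ → S) →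
               I (s 0) →
               (∀ i → R (s i) (s (suc i))) →
               Computation

  data IsFinite : Computation → Set where
    isFinite : ∀ {ℓ} {t : Segment ℓ} {init stop} → IsFinite (finite t init stop)

AllPositive : ∀ {n} → Vec ℤ n → Set
AllPositive {n} s = ∀ (k : Fin n) → 0ℤ ℤ.< lookup s k

whileLoop : ∀ {n m} → (Fin m → Vec ℤ (suc n) → Vec ℤ n) → Program
whileLoop {n} g = record
  { S = Vec ℤ n
  ; I = U
  ; R = λ s t → AllPositive s × ∃[ i ] ∃[ u ] t ≡ g i (s ∷ʳ u)
  }

{-# OPTIONS --safe #-}
-- This is Dickson's lemma: no infinite sequence in ℕⁿ has every later term
-- smaller than every earlier one in some coordinate.  Classically one thins the
-- sequence to make one coordinate after another nondecreasing.  As the goal is ⊥,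
-- infinite sets of indices are taken in the ¬¬ sense; the thinned set consists of
-- the indices whose value is minimal among all later ones, so that it is given by
-- a predicate and no choice of a subsequence is made.
module Submission where

open import Data.Nat using (ℕ; suc; _≤_)
open import Data.Fin using (Fin)
open import Data.Integer using (ℤ; _<_)
open import Data.Vec using (Vec; lookup)
open import Data.Product using (∃-syntax)
open import Defs

import Data.Nat as ℕ
import Data.Nat.Properties as ℕ
open import Data.Empty using (⊥; ⊥-elim)
open import Data.Fin using (zero; suc; toℕ)
open import Data.Fin.Properties using (toℕ-fromℕ; toℕ-inject₁)
open import Data.Integer using (0ℤ; ∣_∣; +<+)
open import Data.Nat.Induction using (<-wellFounded)
open import Data.Product using (_×_; _,_; proj₁)
open import Data.Unit using (tt)
open import Function using (_∘_)
open import Induction.WellFounded using (WellFounded; Acc; acc)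
open import Level using (0ℓ)
open import Relation.Binary using (Rel)
open import Relation.Binary.PropositionalEquality using (_≡_; refl; sym; subst)
open import Relation.Nullary using (¬_)
open import Relation.Unary using (Pred; U)

Infinite : Pred ℕ 0ℓ → Set
Infinite A = ∀ N → ¬ ¬ (∃[ j ] N ≤ j × A j)

U-infinite : Infinite U
U-infinite N none = none (N , ℕ.≤-refl , tt)

module _ {X : Set} {_≺_ : Rel X 0ℓ} where

  FutureMinimal : Pred ℕ 0ℓ → (ℕ → X) → Pred ℕ 0ℓ
  FutureMinimal A f j = A j × (∀ k → A k → j ≤ k → ¬ (f k ≺ f j))

  -- Well-founded induction on `f j`: an element `k` of `A` beyond `j` with a smaller value is
  -- refuted by induction, so `j` itself is future-minimal, against `none`.
  futureMinimal-infinite : WellFounded _≺_ → ∀ {A} (f : ℕ → X) →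
                           Infinite A → Infinite (FutureMinimal A f)
  futureMinimal-infinite wf {A} f inf N none =
    inf N λ { (j , N≤j , Aj) → noElement j N≤j Aj (wf (f j)) }
    where
    noElement : ∀ j → N ≤ j → A j → Acc _≺_ (f j) → ⊥
    noElement j N≤j Aj (acc smaller) =
      none (j , N≤j , Aj , λ k Ak j≤k fk≺fj →
        noElement k (ℕ.≤-trans N≤j j≤k) Ak (smaller fk≺fj))

  -- Relativising to `A` lets the induction on `n` pass to a thinner set while keeping the original
  -- indices.
  dickson : WellFounded _≺_ → ∀ n {A} (f : ℕ → Fin n → X) → Infinite A →
            ¬ (∀ {i j} → A i → A j → i ℕ.< j → ∃[ k ] f j k ≺ f i k)
  dickson wf ℕ.zero f inf bad =
    inf 0 λ { (i , _ , Ai) → inf (suc i) λ { (j , i<j , Aj) → noIndex (bad Ai Aj i<j) } }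
    where
    noIndex : ∀ {P : Fin 0 → Set} → ¬ (∃[ k ] P k)
    noIndex (() , _)
  dickson wf (suc n) {A} f inf bad =
    dickson wf n (λ i → f i ∘ suc) (futureMinimal-infinite wf f₀ inf) bad′
    where
    f₀ : ℕ → X
    f₀ i = f i zero

    bad′ : ∀ {i j} → FutureMinimal A f₀ i → FutureMinimal A f₀ j → i ℕ.< j →
           ∃[ k ] f j (suc k) ≺ f i (suc k)
    bad′ {i} {j} (Ai , min) (Aj , _) i<j with bad Ai Aj i<j
    -- Minimality of `i` forbids a drop in the head coordinate, so the drop lies in the tail.
    ... | zero  , fj≺fi = ⊥-elim (min j Aj (ℕ.<⇒≤ i<j) fj≺fi)
    ... | suc k , fj≺fi = k , fj≺fi

∣∣-mono-<-pos : ∀ {x y} → 0ℤ < x → x < y → ∣ x ∣ ℕ.< ∣ y ∣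
∣∣-mono-<-pos (+<+ _) (+<+ x<y) = x<y

module _ (P : Program) where
  open Program P

  window : (s : ℕ → S) → (∀ i → R (s i) (s (suc i))) → ∀ i ℓ → Segment P ℓ
  window s step i ℓ = record
    -- With `i` as the right summand, the first state is `s i` by computation, and only `inject₁`
    -- needs a transport.
    { state = λ k → s (toℕ k ℕ.+ i)
    ; step  = λ k → subst (λ p → R (s (p ℕ.+ i)) (s (suc (toℕ k) ℕ.+ i)))
                          (sym (toℕ-inject₁ k)) (step (toℕ k ℕ.+ i))
    }

  window-last : ∀ s step {i j} → i ≤ j → Segment.last (window s step i (j ℕ.∸ i)) ≡ s j
  window-last s step {i} {j} i≤j
    rewrite toℕ-fromℕ (j ℕ.∸ i) | ℕ.m∸n+n≡m i≤j = refl

theorem7p1 : ∀ (n m : ℕ) → 1 ≤ n → 1 ≤ m →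
    (g : Fin m → Vec ℤ (suc n) → Vec ℤ n) →
    (∀ i → Computable (g i)) →
    (∀ (ℓ : ℕ) (t : Segment (whileLoop g) ℓ) → 2 ≤ suc ℓ →
    ∃[ k ] lookup (Segment.last t) k < lookup (Segment.first t) k) →
    ∀ (c : Computation (whileLoop g)) → IsFinite (whileLoop g) c
theorem7p1 n m _ _ g _ decrease (finite t init stop) = isFinite
theorem7p1 n m _ _ g _ decrease (infinite s _ step) =
  ⊥-elim (dickson <-wellFounded n (λ i k → ∣ lookup (s i) k ∣) U-infinite
            λ _ _ → descent)
  where
  descent : ∀ {i j} → i ℕ.< j → ∃[ k ] ∣ lookup (s j) k ∣ ℕ.< ∣ lookup (s i) k ∣
  descent {i} {j} i<j
    with decrease (j ℕ.∸ i) (window (whileLoop g) s step i (j ℕ.∸ i))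
                  (ℕ.s≤s (ℕ.m<n⇒0<n∸m i<j))
  -- The loop takes a further step from `s j`, so its guard holds there: the smaller value is
  -- positive, and the descent carries over to absolute values in ℕ.
  ... | k , last<first = k , ∣∣-mono-<-pos (proj₁ (step j) k)
    (subst (λ t → lookup t k < lookup (s i) k)
           (window-last (whileLoop g) s step (ℕ.<⇒≤ i<j)) last<first)
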